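{- Let $\Sigma=\{a,b\}$. There exist a morphism $h:\Sigma^*\to\Sigma^*$, a finite abelian group $G$ and a monoid morphism $f:\Sigma^*\to G$ satisfying Dekking's conditions (D1)--(D4) with $n=11$, so that $h$ is abelian $11$-power free, and such that $h$ has an infinite fixed point $\Omega_2'\in\Sigma^{\mathbb{N}}$ with the following properties: (i) $aaaa$ is not a factor of $\Omega_2'$; (ii) $bb$ is not a factor of $\Omega_2'$; (iii) $\Omega_2'$ is abelian $11$-power free.
   Context: $\Sigma^*$ is the free monoid of finite words over $\Sigma$, with empty word $\epsilon$; a morphism is a monoid homomorphism, extended letter by letter to infinite words; an infinite word $\Omega$ is a fixed point of $h$ if $h(\Omega)=\Omega$. A factor is a contiguous finite subword. The Parikh vector $\psi(u)$ records the number of occurrences of each letter in $u$. The frequency matrix of $h$ is the matrix whose $i$-th row is the Parikh vector of $h(\sigma_i)$, where $\Sigma=\{\sigma_1,\sigma_2\}$. $\operatorname{Pref}(h)$ is the set of all prefixes (including $\epsilon$ and the full word) of the words $h(\sigma)$, $\sigma\in\Sigma$; $h(\Sigma)=\{h(\sigma):\sigma\in\Sigma\}$. A word $u$ (finite or infinite) is abelian $k$-power free if whenever $u=xv_1\cdots v_ky$ with $\psi(v_1)=\cdots=\psi(v_k)$, one has $v_1=\cdots=v_k=\epsilon$. A morphism $h$ is abelian $n$-power free if $h(u)$ is abelian $n$-power free for every abelian $n$-power free word $u$. Dekking's conditions for $(h,G,f,n)$, $G$ written additively: (D1) The frequency matrix of $h$ is non-singular. (D2) $f(h(\sigma))=0$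 for each $\sigma\in\Sigma$. (D3) The set $f(\operatorname{Pref}(h))$ contains no arithmetic progression $g,g+d,\dots,g+nd$ of length $n+1$ with $d\ne0$. (D4) For any positive integer $r$, if $f(v_1)=\cdots=f(v_r)$ with $v_i\in\operatorname{Pref}(h)\setminus h(\Sigma)$ for all $i$, then either $v_1=\cdots=v_r$ or $v_1'=\cdots=v_r'$, where $v_iv_i'=h(\sigma_{j_i})$ for some $\sigma_{j_i}\in\Sigma$. Dekking's theorem states that (D1)--(D4) with $n>1$ imply that $h$ is abelian $n$-power free. -}

module Defs where

open import Level using (0ℓ)
open import Algebra.Bundles using (AbelianGroup)
import Algebra.Definitions.RawMonoid as RawMonoidDefs
open import Algebra.Morphism.Structures using (IsMonoidHomomorphism)
open import Data.Fin using (Fin; zero; suc; _≟_)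
open import Data.Integer as ℤ using (ℤ; +_; 0ℤ)
open import Data.List using (List; []; _∷_; _++_; [_]; concat; length; applyUpTo; filter; ++-[]-rawMonoid)
open import Data.Nat using (ℕ; zero; suc; _≤_; _>_)
open import Data.Product using (∃₂; ∃-syntax; _×_)
open import Data.Sum using (_⊎_)
open import Data.Vec using (Vec; lookup; toList)
open import Function.Bundles using (Inverse)
open import Relation.Binary.PropositionalEquality as ≡ using (_≡_; _≢_; _≗_)
open import Relation.Nullary using (¬_)
open import Relation.Unary using (Pred; _∈_; _∉_)

Letter : Set
Letter = Fin 2

pattern a = zero
pattern b = suc zero

Word : Set
Word = List Letter

InfWord : Set
InfWord = ℕ → Letter

infixr 5 _++∞_

_++∞_ : Word → InfWord → InfWord
([]      ++∞ y) n       = y n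
((c ∷ w) ++∞ y) zero    = c
((c ∷ w) ++∞ y) (suc n) = (w ++∞ y) n

infix 4 _FactorOf∞_

_FactorOf∞_ : Word → InfWord → Set
w FactorOf∞ Ω = ∃₂ λ (x : Word) (y : InfWord) → Ω ≗ x ++∞ w ++∞ y

ψ : Word → Fin 2 → ℕ
ψ u i = length (filter (i ≟_) u)

SameParikh : ∀ {k} → Vec Word k → Set
SameParikh vs = ∀ i j → ψ (lookup vs i) ≗ ψ (lookup vs j)

AllEmpty : ∀ {k} → Vec Word k → Set
AllEmpty vs = ∀ i → lookup vs i ≡ []

AbelianPowerFree : ℕ → Word → Set
AbelianPowerFree k u = ∀ (x : Word) (vs : Vec Word k) (y : Word) →
  u ≡ x ++ concat (toList vs) ++ y → SameParikh vs → AllEmpty vs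

AbelianPowerFree∞ : ℕ → InfWord → Set
AbelianPowerFree∞ k Ω = ∀ (x : Word) (vs : Vec Word k) (y : InfWord) →
  Ω ≗ x ++∞ concat (toList vs) ++∞ y → SameParikh vs → AllEmpty vs

IsMorphism : (Word → Word) → Set
IsMorphism h = IsMonoidHomomorphism (++-[]-rawMonoid Letter) (++-[]-rawMonoid Letter) h

-- Ω′ is the infinite concatenation h(Ω 0) h(Ω 1) h(Ω 2) ⋯ .  The second
-- component says that this concatenation is infinite (h may erase letters);
-- without it a finite h(Ω) would only have to be a prefix of Ω′.
IsImage∞ : (Word → Word) → InfWord → InfWord → Set
IsImage∞ h Ω Ω′ =
  (∀ n → ∃[ y ] Ω′ ≗ h (applyUpTo Ω n) ++∞ y) ×
  (∀ m → ∃[ n ] m ≤ length (h (applyUpTo Ω n)))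

IsFixedPoint : (Word → Word) → InfWord → Set
IsFixedPoint h Ω = IsImage∞ h Ω Ω

-- The word u may be finite or infinite.  An infinite u whose image is finite
-- needs no clause: that image is already the image of a finite prefix of u.
AbelianPowerFreeMorphism : ℕ → (Word → Word) → Set
AbelianPowerFreeMorphism n h =
  (∀ u → AbelianPowerFree n u → AbelianPowerFree n (h u)) ×
  (∀ Ω Ω′ → IsImage∞ h Ω Ω′ → AbelianPowerFree∞ n Ω → AbelianPowerFree∞ n Ω′)

frequencyMatrix : (Word → Word) → Fin 2 → Fin 2 → ℕ
frequencyMatrix h i = ψ (h [ i ])

det₂ : (Fin 2 → Fin 2 → ℤ) → ℤ
det₂ M = M zero zero ℤ.* M (suc zero) (suc zero) ℤ.- M zero (suc zero) ℤ.* M (suc zero) zero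

NonSingular : (Fin 2 → Fin 2 → ℕ) → Set
NonSingular M = det₂ (λ i j → + M i j) ≢ 0ℤ

Pref : (Word → Word) → Pred Word 0ℓ
Pref h v = ∃₂ λ (σ : Letter) (v′ : Word) → v ++ v′ ≡ h [ σ ]

LetterImages : (Word → Word) → Pred Word 0ℓ
LetterImages h v = ∃[ σ ] v ≡ h [ σ ]

-- "Finite" refers to the setoid equality of G, which is in bijection with
-- propositional equality on some Fin m.
IsFinite : AbelianGroup 0ℓ 0ℓ → Set
IsFinite G = ∃[ m ] Inverse (AbelianGroup.setoid G) (≡.setoid (Fin m))

IsMorphismTo : (G : AbelianGroup 0ℓ 0ℓ) → (Word → AbelianGroup.Carrier G) → Set
IsMorphismTo G f = IsMonoidHomomorphism (++-[]-rawMonoid Letter) (AbelianGroup.rawMonoid G) f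

record DekkingConditions (h : Word → Word) (G : AbelianGroup 0ℓ 0ℓ)
                         (f : Word → AbelianGroup.Carrier G) (n : ℕ) : Set where
  open AbelianGroup G using (Carrier; _≈_; rawMonoid)
    renaming (_∙_ to _+_; ε to 0#)
  open RawMonoidDefs rawMonoid using () renaming (_×_ to _·_)

  field
    D1 : NonSingular (frequencyMatrix h)

    D2 : ∀ σ → f (h [ σ ]) ≈ 0#

    D3 : ∀ (g d : Carrier) → ¬ (d ≈ 0#) →
         ¬ (∀ i → i ≤ n → ∃[ v ] (v ∈ Pref h × f v ≈ g + i · d))

    -- The completions v′ i are universally quantified: the alternative must
    -- hold for whichever factorisations v i ++ v′ i ≡ h [ σ i ] are given.
    -- This matters only if some v i is a prefix of both letter images.
    D4 : ∀ r → r > 0 → (σ : Fin r → Letter) (v v′ : Fin r → Word) →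
         (∀ i → v i ++ v′ i ≡ h [ σ i ]) →
         (∀ i → v i ∉ LetterImages h) →
         (∀ i j → f (v i) ≈ f (v j)) →
         (∀ i j → v i ≡ v j) ⊎ (∀ i j → v′ i ≡ v′ j)

{-# OPTIONS --safe #-}

-- Take h : a ↦ aaabaab, b ↦ ababababaab and f : a ↦ 1, b ↦ 4 into ℤ/13; both letter images
-- have value 0.  Twelve terms of an arithmetic progression with nonzero difference omit only
-- one residue modulo 13, but the values 4 and 12 are both omitted by f on Pref(h).
--
-- Dekking's theorem: the n + 1 cut points of an abelian n-power in h(u) fall inside letter
-- images, after prefixes w₀, …, wₙ whose values form a progression because f kills h.  By D3
-- the progression is constant, so by D4 all wⱼ agree or all their completions agree.  Either
-- way the cuts can be moved simultaneously to letter boundaries, and as the frequency matrix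
-- is injective this gives an abelian n-power in u.  Letter images that are not prefixes of
-- one another ensure that no wⱼ is itself a letter image.
--
-- Every letter image begins with a and ends with a single b, so concatenations of images
-- inherit the absence of aaaa and bb from the images.

module Submission where

open import Defs
open import Level using (0ℓ)
open import Algebra.Bundles using (AbelianGroup)
import Algebra.Definitions.RawMonoid as RawMonoidDefs
open import Algebra.Morphism.Structures using (IsMonoidHomomorphism)
import Algebra.Properties.CommutativeSemigroup as CommutativeSemigroupProperties
import Algebra.Properties.Monoid.Mult as MonoidMult
open import Data.Fin using (Fin; zero; suc; toℕ; fromℕ<; #_)
import Data.Fin as Fin
open import Data.Fin.Properties using (all?; any?; toℕ-fromℕ<; toℕ-injective; toℕ≤pred[n]; toℕ<n)
open import Data.Integer as ℤ using (ℤ; +_)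
import Data.Integer.Properties as ℤₚ
import Data.Integer.Tactic.RingSolver as ℤ-Solver
open import Data.List using (List; []; _∷_; _++_; [_]; concat; concatMap; length; foldr; applyUpTo; filter; map)
open import Data.List.Membership.Propositional using () renaming (_∈_ to _∈ₗ_; _∉_ to _∉ₗ_)
import Data.List.Membership.DecPropositional as DecMembership
open import Data.List.Membership.Propositional.Properties using (∈-map⁺)
open import Data.List.Properties using (++-assoc; ++-identityʳ; ∷-injective; length-++; length-applyUpTo; filter-++; length-filter;
  concatMap-++; ++-cancelˡ; ≡-dec)
open import Data.List.Relation.Unary.All as All using (All)
open import Data.List.Relation.Unary.Any using (here; there)
open import Data.Nat using (ℕ; zero; suc; _+_; _*_; _∸_; _≤_; _<_; _>_;
  _≤′_; ≤′-refl; ≤′-step; z≤n; s≤s; NonZero)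
open import Data.Nat.DivMod using (_mod_; _%_; m%n<n; m<n⇒m%n≡m; m%n%n≡m%n; %-distribˡ-+; n%n≡0; m*n%n≡0)
open import Data.Nat.Properties as ℕₚ using (module ≤-Reasoning)
open import Data.Nat.Tactic.RingSolver using (solve-∀)
open import Data.Product using (Σ-syntax; ∃-syntax; ∃₂; _×_; _,_; proj₁; proj₂)
open import Data.Sum using (_⊎_; inj₁; inj₂; [_,_]′)
open import Data.Vec using (Vec; []; _∷_; lookup; toList)
open import Function using (_∘_)
open import Function.Construct.Identity using (inverse)
open import Function.Properties.Inverse using (Inverse⇒Injection)
open import Relation.Binary.PropositionalEquality using (_≡_; _≢_; _≗_; refl; sym; trans; cong; cong₂; subst; subst₂;
  isEquivalence; module ≡-Reasoning)
open import Relation.Nullary using (Dec; ¬_; yes; no; contradiction)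
open import Relation.Nullary.Decidable using (from-yes; via-injection; True; toWitness; ¬?; _→-dec_; _⊎-dec_)
open import Relation.Unary using (_∈_; _∉_)

-- Factorisations of finite words and Parikh vectors.

module ℕₛ = CommutativeSemigroupProperties ℕₚ.+-commutativeSemigroup

-- A tie falls under the first case with `t` empty, so the second case always carries a nonempty
-- overhang. This separates a cut strictly inside a letter image from one at its end.
++-compare : ∀ {A : Set} (xs : List A) {ys} zs {ws} → xs ++ ys ≡ zs ++ ws →
  (∃[ t ] zs ≡ xs ++ t × ys ≡ t ++ ws) ⊎ (∃₂ λ c t → xs ≡ zs ++ c ∷ t × ws ≡ c ∷ t ++ ys)
++-compare []       zs       eq = inj₁ (zs , refl , eq)
++-compare (x ∷ xs) []       eq = inj₂ (x , xs , refl , sym eq)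
++-compare (x ∷ xs) (z ∷ zs) eq with ∷-injective eq
... | refl , eq′ with ++-compare xs zs eq′
...   | inj₁ (t , p , q)     = inj₁ (t , cong (x ∷_) p , q)
...   | inj₂ (c , t , p , q) = inj₂ (c , t , cong (x ∷_) p , q)

-- Listing all factorisations turns statements about `Pref` into finite checks that can be decided
-- by evaluation.
splits : Word → List (Word × Word)
splits []      = ([] , []) ∷ []
splits (c ∷ w) = ([] , c ∷ w) ∷ map (λ (v , v′) → c ∷ v , v′) (splits w)

∈-splits : ∀ v v′ {w} → v ++ v′ ≡ w → (v , v′) ∈ₗ splits w
∈-splits []      []       refl = here refl
∈-splits []      (_ ∷ _)  refl = here refl
∈-splits (c ∷ v) v′       refl = there (∈-map⁺ _ (∈-splits v v′ refl))

ψ-++ : ∀ u v i → ψ (u ++ v) i ≡ ψ u i + ψ v i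
ψ-++ u v i = trans (cong length (filter-++ (i Fin.≟_) u v)) (length-++ (filter (i Fin.≟_) u))

ψ≗0⇒[] : ∀ u → ψ u ≗ ψ [] → u ≡ []
ψ≗0⇒[] []      eq = refl
ψ≗0⇒[] (a ∷ u) eq with () ← eq a
ψ≗0⇒[] (b ∷ u) eq with () ← eq b

-- Infinite words

++∞-assoc : ∀ u v Ω → (u ++ v) ++∞ Ω ≗ u ++∞ v ++∞ Ω
++∞-assoc []      v Ω n       = refl
++∞-assoc (c ∷ u) v Ω zero    = refl
++∞-assoc (c ∷ u) v Ω (suc n) = ++∞-assoc u v Ω n

++∞-congʳ : ∀ u {Ω Ω′} → Ω ≗ Ω′ → u ++∞ Ω ≗ u ++∞ Ω′
++∞-congʳ []      eq n       = eq n
++∞-congʳ (c ∷ u) eq zero    = refl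
++∞-congʳ (c ∷ u) eq (suc n) = ++∞-congʳ u eq n

++∞-local : ∀ u {Ω Ω′ n} → n < length u → (u ++∞ Ω) n ≡ (u ++∞ Ω′) n
++∞-local (c ∷ u) {n = zero}  _       = refl
++∞-local (c ∷ u) {n = suc n} (s≤s p) = ++∞-local u p

agree⇒prefix : ∀ u {y Ω} → (∀ n → n < length u → Ω n ≡ (u ++∞ y) n) →
  Ω ≗ u ++∞ (λ n → Ω (length u + n))
agree⇒prefix []      eq n       = refl
agree⇒prefix (c ∷ u) eq zero    = eq zero (s≤s z≤n)
agree⇒prefix (c ∷ u) eq (suc n) = agree⇒prefix u (λ m m< → eq (suc m) (s≤s m<)) n

applyUpTo-prefix : ∀ (Ω : InfWord) n → Ω ≗ applyUpTo Ω n ++∞ (λ i → Ω (n + i))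
applyUpTo-prefix Ω zero    i       = refl
applyUpTo-prefix Ω (suc n) zero    = refl
applyUpTo-prefix Ω (suc n) (suc i) = applyUpTo-prefix (Ω ∘ suc) n i

prefix-extend : ∀ u w {y z} → length u ≤ length w → u ++∞ y ≗ w ++∞ z → ∃[ s ] w ≡ u ++ s
prefix-extend []      w       _       eq = w , refl
prefix-extend (c ∷ u) (d ∷ w) (s≤s p) eq with eq zero | prefix-extend u w p (eq ∘ suc)
... | refl | s , refl = s , refl

powerFree∞⇒prefix : ∀ {n Ω u y} → Ω ≗ u ++∞ y → AbelianPowerFree∞ n Ω → AbelianPowerFree n u
powerFree∞⇒prefix {y = y} eq pf x vs z refl = pf x vs (z ++∞ y) λ i → begin
  _                                          ≡⟨ eq i ⟩
  ((x ++ concat (toList vs) ++ z) ++∞ y) i   ≡⟨ ++∞-assoc x _ y i ⟩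
  (x ++∞ (concat (toList vs) ++ z) ++∞ y) i  ≡⟨ ++∞-congʳ x (++∞-assoc (concat (toList vs)) z y) i ⟩
  (x ++∞ concat (toList vs) ++∞ z ++∞ y) i   ∎
  where open ≡-Reasoning

HasPrefixesIn : (Word → Set) → InfWord → Set
HasPrefixesIn P Ω = ∀ m → ∃[ u ] P u × m ≤ length u × ∃[ y ] Ω ≗ u ++∞ y

-- A prefix at least as long as `x ++ w` extends it, so every finite factor is already visible in a
-- word satisfying `P`. Power freeness and the absence of given factors both pass to the infinite
-- word this way.
factor-in-prefix : ∀ {P Ω} → HasPrefixesIn P Ω → ∀ x w y → Ω ≗ x ++∞ w ++∞ y →
  ∃[ z ] P (x ++ w ++ z)
factor-in-prefix {P} prefixes x w y eq with prefixes (length (x ++ w))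
... | u , Pu , le , t , eq′
  with prefix-extend (x ++ w) u le (λ i → trans (++∞-assoc x w y i) (trans (sym (eq i)) (eq′ i)))
...   | z , refl = z , subst P (++-assoc x w z) Pu

prefixes⇒powerFree∞ : ∀ {n Ω} → HasPrefixesIn (AbelianPowerFree n) Ω → AbelianPowerFree∞ n Ω
prefixes⇒powerFree∞ prefixes x vs y eq with factor-in-prefix prefixes x (concat (toList vs)) y eq
... | z , pf = pf x vs z refl

-- Finite prefixes of `Ω` inherit power freeness, and their images are arbitrarily long prefixes of
-- `Ω′`.
powerFree⇒morphism : ∀ {n h} → (∀ u → AbelianPowerFree n u → AbelianPowerFree n (h u)) →
  AbelianPowerFreeMorphism n h
powerFree⇒morphism {h = h} pres = pres , λ Ω Ω′ (prefix , unbounded) pf → prefixes⇒powerFree∞ λ m →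
  let k , m≤ = unbounded m
  in h (applyUpTo Ω k) , pres _ (powerFree∞⇒prefix (applyUpTo-prefix Ω k) pf) , m≤ , prefix k

-- Dekking's theorem

-- Cramer's rule over ℤ, without division: each coordinate times the determinant is recovered from
-- the two column equations, and the nonzero determinant is then cancelled.
det₂-cancel : ∀ (M : Fin 2 → Fin 2 → ℕ) → NonSingular M → ∀ (x y : Fin 2 → ℕ) →
  (∀ c → x a * M a c + x b * M b c ≡ y a * M a c + y b * M b c) → x ≗ y
det₂-cancel M D1 x y eq = λ where
    a → ℤₚ.+-injective (ℤₚ.*-cancelʳ-≡ _ _ det (begin
      + x a ℤ.* det                              ≡⟨ cramer-a A B C D (+ x a) (+ x b) ⟩
      D ℤ.* combination x a ℤ.- C ℤ.* combination x b  ≡⟨ cong₂ (λ s t → D ℤ.* s ℤ.- C ℤ.* t) (column a) (column b) ⟩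
      D ℤ.* combination y a ℤ.- C ℤ.* combination y b  ≡⟨ cramer-a A B C D (+ y a) (+ y b) ⟨
      + y a ℤ.* det                              ∎))
    b → ℤₚ.+-injective (ℤₚ.*-cancelʳ-≡ _ _ det (begin
      + x b ℤ.* det                              ≡⟨ cramer-b A B C D (+ x a) (+ x b) ⟩
      A ℤ.* combination x b ℤ.- B ℤ.* combination x a  ≡⟨ cong₂ (λ s t → A ℤ.* s ℤ.- B ℤ.* t) (column b) (column a) ⟩
      A ℤ.* combination y b ℤ.- B ℤ.* combination y a  ≡⟨ cramer-b A B C D (+ y a) (+ y b) ⟨
      + y b ℤ.* det                              ∎))
  where
  open ≡-Reasoning

  A = + M a a
  B = + M a b
  C = + M b a
  D = + M b b
  det = A ℤ.* D ℤ.- B ℤ.* C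

  instance
    det≢0 : ℤ.NonZero det
    det≢0 = ℤ.≢-nonZero D1

  combination : (Fin 2 → ℕ) → Fin 2 → ℤ
  combination z c = + z a ℤ.* + M a c ℤ.+ + z b ℤ.* + M b c

  combination-pos : ∀ z c → + (z a * M a c + z b * M b c) ≡ combination z c
  combination-pos z c = trans (ℤₚ.pos-+ (z a * M a c) _) (cong₂ ℤ._+_ (ℤₚ.pos-* (z a) _) (ℤₚ.pos-* (z b) _))

  column : ∀ c → combination x c ≡ combination y c
  column c = trans (sym (combination-pos x c)) (trans (cong +_ (eq c)) (combination-pos y c))

  cramer-a : ∀ A B C D s t →
    s ℤ.* (A ℤ.* D ℤ.- B ℤ.* C) ≡ D ℤ.* (s ℤ.* A ℤ.+ t ℤ.* C) ℤ.- C ℤ.* (s ℤ.* B ℤ.+ t ℤ.* D)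
  cramer-a = ℤ-Solver.solve-∀

  cramer-b : ∀ A B C D s t →
    t ℤ.* (A ℤ.* D ℤ.- B ℤ.* C) ≡ A ℤ.* (s ℤ.* B ℤ.+ t ℤ.* D) ℤ.- B ℤ.* (s ℤ.* A ℤ.+ t ℤ.* C)
  cramer-b = ℤ-Solver.solve-∀

-- Index `i` marks the end of the `i`-th block and index zero the start of the first, so `n` blocks
-- give `n + 1` cut points, the length of progression excluded by D3.
cutPrefix : ∀ {n} → Word → Vec Word n → Fin (suc n) → Word
cutPrefix x vs       zero    = x
cutPrefix x (v ∷ vs) (suc i) = cutPrefix (x ++ v) vs i

cutPrefix-prefix : ∀ {n} x (vs : Vec Word n) y i → ∃[ s ] x ++ concat (toList vs) ++ y ≡ cutPrefix x vs i ++ s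
cutPrefix-prefix x vs       y zero    = _ , refl
cutPrefix-prefix x (v ∷ vs) y (suc i) with cutPrefix-prefix (x ++ v) vs y i
... | s , eq = s , trans regroup eq
  where
  regroup : x ++ (v ++ concat (toList vs)) ++ y ≡ (x ++ v) ++ concat (toList vs) ++ y
  regroup = trans (cong (x ++_) (++-assoc v _ y)) (sym (++-assoc x v _))

module Dekking
  {h : Word → Word} {G : AbelianGroup 0ℓ 0ℓ} {f : Word → AbelianGroup.Carrier G} {n : ℕ}
  (h-homo : IsMorphism h) (finite : IsFinite G) (f-homo : IsMorphismTo G f)
  (dekking : DekkingConditions h G f n)
  (prefix-code : ∀ σ τ v → h [ σ ] ++ v ≡ h [ τ ] → v ≡ [])
  where

  open AbelianGroup G using (Carrier; _≈_; _∙_; ε; ∙-cong; ∙-congˡ; ∙-congʳ; identityˡ; identityʳ; assoc; monoid; setoid)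
    renaming (refl to ≈-refl; sym to ≈-sym; trans to ≈-trans)
  open RawMonoidDefs (AbelianGroup.rawMonoid G) using () renaming (_×_ to _·_)
  open MonoidMult monoid using (×-congˡ)
  open DekkingConditions dekking
  module H = IsMonoidHomomorphism h-homo
  module F = IsMonoidHomomorphism f-homo
  open import Relation.Binary.Reasoning.Setoid setoid

  -- Finiteness of `G` makes its equality decidable, which permits the case distinctions on `d` and
  -- `f x` in `preserves`.
  _≈?_ : ∀ g g′ → Dec (g ≈ g′)
  _≈?_ = via-injection (Inverse⇒Injection (proj₂ finite)) Fin._≟_

  ψ-h : ∀ u c → ψ (h u) c ≡ ψ u a * frequencyMatrix h a c + ψ u b * frequencyMatrix h b c
  ψ-h []      c rewrite H.ε-homo = refl
  ψ-h (σ ∷ u) c rewrite H.homo [ σ ] u | ψ-++ (h [ σ ]) (h u) c | ψ-h u c = count σ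
    where
    count : ∀ σ → frequencyMatrix h σ c + (ψ u a * frequencyMatrix h a c + ψ u b * frequencyMatrix h b c) ≡
                  ψ (σ ∷ u) a * frequencyMatrix h a c + ψ (σ ∷ u) b * frequencyMatrix h b c
    count a = sym (ℕₚ.+-assoc (frequencyMatrix h a c) _ _)
    count b = ℕₛ.x∙yz≈y∙xz (frequencyMatrix h b c) (ψ u a * frequencyMatrix h a c) _

  ψ-h-injective : ∀ u v → ψ (h u) ≗ ψ (h v) → ψ u ≗ ψ v
  ψ-h-injective u v eq = det₂-cancel (frequencyMatrix h) D1 (ψ u) (ψ v) λ c →
    trans (sym (ψ-h u c)) (trans (eq c) (ψ-h v c))

  -- In an abelian group only the letter counts matter. Hence all blocks of an abelian power share
  -- one value, the difference of the progression.
  f-ψ : ∀ u → f u ≈ (ψ u a · f [ a ]) ∙ (ψ u b · f [ b ])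
  f-ψ []      = ≈-trans F.ε-homo (≈-sym (identityˡ ε))
  f-ψ (σ ∷ u) = ≈-trans (F.homo [ σ ] u) (≈-trans (∙-congˡ (f-ψ u)) (count σ))
    where
    count : ∀ σ → f [ σ ] ∙ ((ψ u a · f [ a ]) ∙ (ψ u b · f [ b ])) ≈
                  (ψ (σ ∷ u) a · f [ a ]) ∙ (ψ (σ ∷ u) b · f [ b ])
    count a = ≈-sym (assoc _ _ _)
    count b = x∙yz≈y∙xz _ _ _
      where open CommutativeSemigroupProperties (AbelianGroup.commutativeSemigroup G) using (x∙yz≈y∙xz)

  f-cong-ψ : ∀ u v → ψ u ≗ ψ v → f u ≈ f v
  f-cong-ψ u v eq = begin
    f u                                    ≈⟨ f-ψ u ⟩
    (ψ u a · f [ a ]) ∙ (ψ u b · f [ b ])  ≈⟨ ∙-cong (×-congˡ (eq a)) (×-congˡ (eq b)) ⟩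
    (ψ v a · f [ a ]) ∙ (ψ v b · f [ b ])  ≈⟨ f-ψ v ⟨
    f v                                    ∎

  f∘h≈ε : ∀ u → f (h u) ≈ ε
  f∘h≈ε []      = ≈-trans (F.⟦⟧-cong H.ε-homo) F.ε-homo
  f∘h≈ε (σ ∷ u) = begin
    f (h (σ ∷ u))          ≈⟨ F.⟦⟧-cong (H.homo [ σ ] u) ⟩
    f (h [ σ ] ++ h u)     ≈⟨ F.homo (h [ σ ]) (h u) ⟩
    f (h [ σ ]) ∙ f (h u)  ≈⟨ ∙-cong (D2 σ) (f∘h≈ε u) ⟩
    ε ∙ ε                  ≈⟨ identityˡ ε ⟩
    ε                      ∎

  -- The factorisation is kept as data because the second alternative of D4 compares completions.
  -- Properness is stated by a nonempty completion, and `prefix-code` turns this into not being a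
  -- letter image.
  record ProperPrefix (w : Word) : Set where
    constructor properPrefix
    field
      letter     : Letter
      completion : Word
      factors    : w ++ completion ≡ h [ letter ]
      proper     : completion ≢ []

    notImage : w ∉ LetterImages h
    notImage (τ , refl) = proper (prefix-code τ letter completion factors)

  open ProperPrefix

  -- An erased letter would have the same image as the empty word, against the injectivity on Parikh
  -- vectors that D1 provides.
  h-letter≢[] : ∀ σ → h [ σ ] ≢ []
  h-letter≢[] σ eq = contradiction (ψ≗0⇒[] [ σ ] (ψ-h-injective [ σ ] [] λ c → cong (λ w → ψ w c) (trans eq (sym H.ε-homo)))) λ ()

  -- D4 applied to w together with the empty prefix of both letter images, which differ by D1.
  proper-kernel : ∀ {w} → ProperPrefix w → f w ≈ ε → w ≡ []
  proper-kernel {w} pw fw≈ε =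
    [ (λ same → same zero (suc zero))
    , (λ same → contradiction (ψ-h-injective [ a ] [ b ] (λ c → cong (λ v → ψ v c) (same (suc zero) (suc (suc zero)))) a) (λ ()))
    ]′ (D4 3 (s≤s z≤n) (λ { zero → letter pw ; (suc i) → i })
          family (λ { zero → completion pw ; (suc i) → h [ i ] })
          (λ { zero → factors pw ; (suc _) → refl })
          (λ { zero → notImage pw ; (suc i) (τ , eq) → h-letter≢[] τ (sym eq) })
          (λ i j → ≈-trans (vanishes i) (≈-sym (vanishes j))))
    where
    family : Fin 3 → Word
    family zero    = w
    family (suc _) = []

    vanishes : ∀ i → f (family i) ≈ ε
    vanishes zero    = fw≈ε
    vanishes (suc _) = F.ε-homo

  -- The first alternative of `position` serves the end of `u`, where no letter follows. Elsewhere
  -- `cutAt` places the cut in the image of the next letter, possibly after its empty prefix.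
  record Cut (u p : Word) : Set where
    constructor cut
    field
      before after inside : Word
      splits-word  : u ≡ before ++ after
      splits-image : p ≡ h before ++ inside
      position     : inside ≡ [] ⊎ Σ[ pw ∈ ProperPrefix inside ] ∃[ r ] after ≡ letter pw ∷ r

    f-cut : f p ≈ f inside
    f-cut = begin
      f p                        ≈⟨ F.⟦⟧-cong splits-image ⟩
      f (h before ++ inside)     ≈⟨ F.homo (h before) inside ⟩
      f (h before) ∙ f inside    ≈⟨ ∙-congʳ (f∘h≈ε before) ⟩
      ε ∙ f inside               ≈⟨ identityˡ _ ⟩
      f inside                   ∎

    inside-Pref : inside ∈ Pref h
    inside-Pref with position
    ... | inj₁ p        = a , h [ a ] , cong (_++ h [ a ]) p
    ... | inj₂ (pw , _) = letter pw , completion pw , factors pw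

  open Cut

  cutAt : ∀ u p s → h u ≡ p ++ s → Cut u p
  cutAt []      []      s eq = cut [] [] [] refl (sym (trans (++-identityʳ _) H.ε-homo)) (inj₁ refl)
  cutAt []      (_ ∷ _) s eq with () ← trans (sym H.ε-homo) eq
  cutAt (σ ∷ u) p       s eq with ++-compare (h [ σ ]) p (trans (sym (H.homo [ σ ] u)) eq)
  -- The image of `σ` reaches strictly beyond `p`; the overhang `c ∷ t` is the completion.
  ... | inj₂ (c , t , image , _) =
    cut [] (σ ∷ u) p refl (cong (_++ p) (sym H.ε-homo)) (inj₂ (properPrefix σ (c ∷ t) (sym image) (λ ()) , u , refl))
  ... | inj₁ (t , refl , rest) with cutAt u t s rest
  ...   | cut q r w word image pos =
    cut (σ ∷ q) r w (cong (σ ∷_) word) image′ pos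
    where
    image′ : h [ σ ] ++ t ≡ h (σ ∷ q) ++ w
    image′ = trans (cong (h [ σ ] ++_) image)
      (trans (sym (++-assoc (h [ σ ]) (h q) w)) (cong (_++ w) (sym (H.homo [ σ ] q))))

  f-cutPrefix : ∀ {k} x (vs : Vec Word k) d → (∀ i → f (lookup vs i) ≈ d) → ∀ i →
    f (cutPrefix x vs i) ≈ f x ∙ (toℕ i · d)
  f-cutPrefix x vs       d eq zero    = ≈-sym (identityʳ (f x))
  f-cutPrefix x (v ∷ vs) d eq (suc i) = begin
    f (cutPrefix (x ++ v) vs i)    ≈⟨ f-cutPrefix (x ++ v) vs d (eq ∘ suc) i ⟩
    f (x ++ v) ∙ (toℕ i · d)       ≈⟨ ∙-congʳ (F.homo x v) ⟩
    (f x ∙ f v) ∙ (toℕ i · d)      ≈⟨ ∙-congʳ (∙-congˡ (eq zero)) ⟩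
    (f x ∙ d) ∙ (toℕ i · d)        ≈⟨ assoc _ _ _ ⟩
    f x ∙ (suc (toℕ i) · d)        ∎

  -- Prefixes of u whose images lie at a constant Parikh distance from the cuts of an
  -- abelian power cut out preimages of its blocks, up to abelian equivalence.
  pullBack : ∀ {k} u x (vs : Vec Word k) (q : Fin (suc k) → Word) (C C′ : Fin 2 → ℕ) →
    (∀ i → ∃[ r ] u ≡ q i ++ r) →
    (∀ i c → ψ (h (q i)) c + C c ≡ ψ (cutPrefix x vs i) c + C′ c) →
    Σ[ ts ∈ Vec Word k ] (∃[ r ] u ≡ q zero ++ concat (toList ts) ++ r) ×
                         (∀ i → ψ (h (lookup ts i)) ≗ ψ (lookup vs i))
  pullBack u x []       q C C′ prefix offset = [] , prefix zero , λ ()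
  pullBack u x (v ∷ vs) q C C′ prefix offset
    with prefix zero | prefix (suc zero) | pullBack u (x ++ v) vs (q ∘ suc) C C′ (prefix ∘ suc) (offset ∘ suc)
  ... | r₀ , eq₀ | r₁ , eq₁ | ts , (r , eq) , same
    with ++-compare (q zero) (q (suc zero)) (trans (sym eq₀) eq₁)
  ...   | inj₁ (t , q₁ , _) = t ∷ ts , (r , word) , λ { zero → block ; (suc i) → same i }
    where
    word : u ≡ q zero ++ (t ++ concat (toList ts)) ++ r
    word = trans eq (trans (cong (_++ concat (toList ts) ++ r) q₁)
      (trans (++-assoc (q zero) t _) (cong (q zero ++_) (sym (++-assoc t _ r)))))

    block : ψ (h t) ≗ ψ v
    block c = cancel (ψ (h (q zero)) c) (ψ x c) (C c) (C′ c) (offset zero c)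
      (subst₂ (λ m k → m + C c ≡ k + C′ c) image (ψ-++ x v c) (offset (suc zero) c))
      where
      image : ψ (h (q (suc zero))) c ≡ ψ (h (q zero)) c + ψ (h t) c
      image = trans (cong (λ w → ψ (h w) c) q₁)
        (trans (cong (λ w → ψ w c) (H.homo (q zero) t)) (ψ-++ (h (q zero)) (h t) c))

      cancel : ∀ m l e e′ {k o} → m + e ≡ l + e′ → (m + k) + e ≡ (l + o) + e′ → k ≡ o
      cancel m l e e′ {k} {o} p p′ = ℕₚ.+-cancelˡ-≡ (m + e) k o
        (trans (ℕₛ.xy∙z≈xz∙y m e k) (trans p′ (trans (sym (ℕₛ.xy∙z≈xz∙y l e′ o)) (cong (_+ o) (sym p)))))
  -- Were the preimages of consecutive cuts in the wrong order, the two offset equations would give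
  -- the surplus `σ ∷ t` an image with zero Parikh vector.
  ...   | inj₂ (σ , t , q₀ , _) = contradiction (ψ≗0⇒[] (σ ∷ t) (ψ-h-injective (σ ∷ t) [] vanishes)) λ ()
    where
    vanishes : ψ (h (σ ∷ t)) ≗ ψ (h [])
    vanishes c = trans
      (vanish (ψ (h (q (suc zero))) c) (ψ x c) (C c) (C′ c)
        (subst (λ m → m + C c ≡ _) image (offset zero c))
        (subst (λ k → _ ≡ k + C′ c) (ψ-++ x v c) (offset (suc zero) c)))
      (sym (cong (λ w → ψ w c) H.ε-homo))
      where
      image : ψ (h (q zero)) c ≡ ψ (h (q (suc zero))) c + ψ (h (σ ∷ t)) c
      image = trans (cong (λ w → ψ (h w) c) q₀)
        (trans (cong (λ w → ψ w c) (H.homo (q (suc zero)) (σ ∷ t))) (ψ-++ (h (q (suc zero))) (h (σ ∷ t)) c))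

      vanish : ∀ m l e e′ {k o} → (m + k) + e ≡ l + e′ → m + e ≡ (l + o) + e′ → k ≡ 0
      vanish m l e e′ {k} {o} p p′ = ℕₚ.m+n≡0⇒m≡0 k {o} (ℕₚ.+-cancelˡ-≡ (m + e) (k + o) 0
        (trans (regroup m e k o) (trans (cong (_+ o) p) (trans (ℕₛ.xy∙z≈xz∙y l e′ o) (trans (sym p′) (sym (ℕₚ.+-identityʳ _)))))))
        where
        regroup : ∀ m e k o → (m + e) + (k + o) ≡ ((m + k) + e) + o
        regroup = solve-∀

  -- Injectivity on Parikh vectors makes the pulled-back blocks an abelian `n`-power in `u`, so they
  -- are empty; the blocks of `vs` have the Parikh vectors of their images, so these are empty too.
  pulledBack⇒empty : ∀ {u} x (vs : Vec Word n) (q : Fin (suc n) → Word) (C C′ : Fin 2 → ℕ) →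
    AbelianPowerFree n u → SameParikh vs →
    (∀ i → ∃[ r ] u ≡ q i ++ r) →
    (∀ i c → ψ (h (q i)) c + C c ≡ ψ (cutPrefix x vs i) c + C′ c) →
    AllEmpty vs
  pulledBack⇒empty {u} x vs q C C′ pf parikh prefix offset i
    with pullBack u x vs q C C′ prefix offset
  ... | ts , (r , eq) , same = ψ≗0⇒[] (lookup vs i) λ c →
    trans (sym (same i c)) (cong (λ w → ψ w c) (trans (cong h (ts-empty i)) H.ε-homo))
    where
    ts-empty : AllEmpty ts
    ts-empty = pf (q zero) ts r eq λ j k → ψ-h-injective (lookup ts j) (lookup ts k) λ c →
      trans (same j c) (trans (parikh j k c) (sym (same k c)))

  preserves : ∀ u → AbelianPowerFree n u → AbelianPowerFree n (h u)
  preserves u pf x vs y eq parikh k = conclude k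
    where
    cuts : ∀ i → Cut u (cutPrefix x vs i)
    cuts i with cutPrefix-prefix x vs y i
    ... | s , eq′ = cutAt u (cutPrefix x vs i) s (trans eq eq′)

    d : Carrier
    -- The index `k` at which emptiness is to be shown names a block, and every block has its value.
    d = f (lookup vs k)

    progression : ∀ i → f (inside (cuts i)) ≈ f x ∙ (toℕ i · d)
    progression i = ≈-trans (≈-sym (f-cut (cuts i))) (f-cutPrefix x vs d (λ j → f-cong-ψ _ _ (parikh j k)) i)

    d≈ε : d ≈ ε
    d≈ε with d ≈? ε
    ... | yes p = p
    ... | no ¬p = contradiction
      (λ i i≤n → let j = fromℕ< (s≤s i≤n) in
        inside (cuts j) , inside-Pref (cuts j) ,
        subst (λ m → f (inside (cuts j)) ≈ f x ∙ (m · d)) (toℕ-fromℕ< (s≤s i≤n)) (progression j))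
      (D3 (f x) d ¬p)

    constant : ∀ i → f (inside (cuts i)) ≈ f x
    constant i = ≈-trans (progression i) (≈-trans (∙-congˡ (multiple (toℕ i))) (identityʳ (f x)))
      where
      multiple : ∀ m → m · d ≈ ε
      multiple zero    = ≈-refl
      multiple (suc m) = ≈-trans (∙-cong d≈ε (multiple m)) (identityˡ ε)

    -- Every cut is moved left to the start of its letter image. This removes the same Parikh vector
    -- each time, recorded as the offset `C`.
    same-inside⇒empty : (∀ i → inside (cuts i) ≡ inside (cuts zero)) → AllEmpty vs
    same-inside⇒empty same = pulledBack⇒empty x vs (before ∘ cuts) (ψ (inside (cuts zero))) (λ _ → 0) pf parikh
      (λ i → after (cuts i) , splits-word (cuts i)) offset
      where
      offset : ∀ i c → ψ (h (before (cuts i))) c + ψ (inside (cuts zero)) c ≡ ψ (cutPrefix x vs i) c + 0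
      offset i c = trans (cong (λ w → ψ (h (before (cuts i))) c + ψ w c) (sym (same i)))
        (trans (sym (ψ-++ (h (before (cuts i))) (inside (cuts i)) c))
        (trans (cong (λ w → ψ w c) (sym (splits-image (cuts i)))) (sym (ℕₚ.+-identityʳ _))))

    conclude : AllEmpty vs
    -- If the common value vanishes, `proper-kernel` puts every cut on an image boundary, the end of
    -- `u` included. Otherwise every cut is strictly inside a letter image, and D4 applies to the
    -- whole family.
    conclude with f x ≈? ε
    ... | yes fx≈ε = same-inside⇒empty λ i → trans (inside-empty i) (sym (inside-empty zero))
      where
      inside-empty : ∀ i → inside (cuts i) ≡ []
      inside-empty i with position (cuts i)
      ... | inj₁ p        = p
      ... | inj₂ (pw , _) = proper-kernel pw (≈-trans (constant i) fx≈ε)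
    ... | no fx≉ε = [ (λ same → same-inside⇒empty (λ i → same i zero)) , same-completion⇒empty ]′
        (D4 (suc n) (s≤s z≤n) (letter ∘ prefixes) (inside ∘ cuts) (completion ∘ prefixes)
          (factors ∘ prefixes) (notImage ∘ prefixes) (λ i j → ≈-trans (constant i) (≈-sym (constant j))))
      where
      interior : ∀ i → Σ[ pw ∈ ProperPrefix (inside (cuts i)) ] ∃[ r ] after (cuts i) ≡ letter pw ∷ r
      interior i with position (cuts i)
      ... | inj₁ p = contradiction (≈-trans (≈-sym (constant i)) (≈-trans (F.⟦⟧-cong p) F.ε-homo)) fx≉ε
      ... | inj₂ p = p

      prefixes : ∀ i → ProperPrefix (inside (cuts i))
      prefixes = proj₁ ∘ interior

      through : Fin (suc n) → Word
      through i = before (cuts i) ++ [ letter (prefixes i) ]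

      through-image : ∀ i → h (through i) ≡ cutPrefix x vs i ++ completion (prefixes i)
      through-image i = trans (H.homo (before (cuts i)) _) (trans (cong (h (before (cuts i)) ++_) (sym (factors (prefixes i))))
        (trans (sym (++-assoc (h (before (cuts i))) _ _)) (cong (_++ completion (prefixes i)) (sym (splits-image (cuts i))))))

      -- Every cut is moved right to the end of its letter image. This adds the same Parikh vector
      -- each time, recorded as the offset `C′`.
      same-completion⇒empty : (∀ i j → completion (prefixes i) ≡ completion (prefixes j)) → AllEmpty vs
      same-completion⇒empty same = pulledBack⇒empty x vs through (λ _ → 0) (ψ (completion (prefixes zero))) pf parikh
        (λ i → proj₁ (proj₂ (interior i)) , trans (splits-word (cuts i))
          (trans (cong (before (cuts i) ++_) (proj₂ (proj₂ (interior i)))) (sym (++-assoc (before (cuts i)) _ _))))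
        (λ i c → trans (ℕₚ.+-identityʳ _) (trans (cong (λ w → ψ w c) (through-image i))
          (trans (ψ-++ (cutPrefix x vs i) _ c) (cong (λ w → ψ (cutPrefix x vs i) c + ψ w c) (same i zero)))))

-- The morphism and its valuation in ℤ/13

image : Letter → Word
image a = a ∷ a ∷ a ∷ b ∷ a ∷ a ∷ b ∷ []
image b = a ∷ b ∷ a ∷ b ∷ a ∷ b ∷ a ∷ b ∷ a ∷ a ∷ b ∷ []

morphism : Word → Word
morphism = concatMap image

morphism-homo : IsMorphism morphism
morphism-homo = record
  { isMagmaHomomorphism = record
    { isRelHomomorphism = record { cong = cong morphism }
    ; homo = concatMap-++ image
    }
  ; ε-homo = refl
  }

ℤ/ : ∀ n .{{_ : NonZero n}} → AbelianGroup 0ℓ 0ℓ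
ℤ/ n = record
  { Carrier = Fin n
  ; _≈_ = _≡_
  ; _∙_ = _⊕_
  ; ε = 0 mod n
  ; _⁻¹ = λ i → (n ∸ toℕ i) mod n
  ; isAbelianGroup = record
    { isGroup = record
      { isMonoid = record
        { isSemigroup = record
          { isMagma = record { isEquivalence = isEquivalence ; ∙-cong = cong₂ _⊕_ }
          ; assoc = ⊕-assoc
          }
        ; identity = ⊕-identityˡ , λ i → trans (⊕-comm i _) (⊕-identityˡ i)
        }
      ; inverse = ⊕-inverseˡ , λ i → trans (⊕-comm i _) (⊕-inverseˡ i)
      ; ⁻¹-cong = cong (λ i → (n ∸ toℕ i) mod n)
      }
    ; comm = ⊕-comm
    }
  }
  where
  open ≡-Reasoning

  _⊕_ : Fin n → Fin n → Fin n
  i ⊕ j = (toℕ i + toℕ j) mod n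

  toℕ-mod : ∀ m → toℕ (m mod n) ≡ m % n
  toℕ-mod m = toℕ-fromℕ< (m%n<n m n)

  mod-cong : ∀ k m → k % n ≡ m % n → k mod n ≡ m mod n
  mod-cong k m eq = toℕ-injective (trans (toℕ-mod k) (trans eq (sym (toℕ-mod m))))

  mod-toℕ : ∀ i → toℕ i mod n ≡ i
  mod-toℕ i = toℕ-injective (trans (toℕ-mod (toℕ i)) (m<n⇒m%n≡m (toℕ<n i)))

  [m%n+k]%n≡[m+k]%n : ∀ m k → (m % n + k) % n ≡ (m + k) % n
  [m%n+k]%n≡[m+k]%n m k = begin
    (m % n + k) % n          ≡⟨ %-distribˡ-+ (m % n) k n ⟩
    (m % n % n + k % n) % n  ≡⟨ cong (λ l → (l + k % n) % n) (m%n%n≡m%n m n) ⟩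
    (m % n + k % n) % n      ≡⟨ %-distribˡ-+ m k n ⟨
    (m + k) % n              ∎

  mod-⊕ : ∀ m j → (m mod n) ⊕ j ≡ (m + toℕ j) mod n
  mod-⊕ m j = mod-cong _ _ (trans (cong (λ l → (l + toℕ j) % n) (toℕ-mod m)) ([m%n+k]%n≡[m+k]%n m (toℕ j)))

  ⊕-comm : ∀ i j → i ⊕ j ≡ j ⊕ i
  ⊕-comm i j = cong (_mod n) (ℕₚ.+-comm (toℕ i) (toℕ j))

  -- `mod-⊕` absorbs a reduction on the left only, so the right-hand bracketing is reached by
  -- rotating the sum and commuting.
  ⊕-assoc : ∀ i j k → (i ⊕ j) ⊕ k ≡ i ⊕ (j ⊕ k)
  ⊕-assoc i j k = begin
    (i ⊕ j) ⊕ k                      ≡⟨ mod-⊕ (toℕ i + toℕ j) k ⟩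
    (toℕ i + toℕ j + toℕ k) mod n    ≡⟨ cong (_mod n) (rotate (toℕ i) (toℕ j) (toℕ k)) ⟩
    (toℕ j + toℕ k + toℕ i) mod n    ≡⟨ mod-⊕ (toℕ j + toℕ k) i ⟨
    (j ⊕ k) ⊕ i                      ≡⟨ ⊕-comm (j ⊕ k) i ⟩
    i ⊕ (j ⊕ k)                      ∎
    where
    rotate : ∀ x y z → x + y + z ≡ y + z + x
    rotate = solve-∀

  ⊕-identityˡ : ∀ i → (0 mod n) ⊕ i ≡ i
  ⊕-identityˡ i = trans (mod-⊕ 0 i) (mod-toℕ i)

  ⊕-inverseˡ : ∀ i → ((n ∸ toℕ i) mod n) ⊕ i ≡ 0 mod n
  ⊕-inverseˡ i = trans (mod-⊕ (n ∸ toℕ i) i) (mod-cong _ 0 (begin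
    (n ∸ toℕ i + toℕ i) % n  ≡⟨ cong (_% n) (ℕₚ.m∸n+n≡m (ℕₚ.<⇒≤ (toℕ<n i))) ⟩
    n % n                    ≡⟨ n%n≡0 n ⟩
    0                        ≡⟨ m*n%n≡0 0 n ⟨
    0 % n                    ∎))

open AbelianGroup (ℤ/ 13) using () renaming (_∙_ to _⊕_; ε to 0₁₃)
open RawMonoidDefs (AbelianGroup.rawMonoid (ℤ/ 13)) using () renaming (_×_ to _·_)

-- The images of `a` and `b` have Parikh vectors (5, 2) and (6, 5), so these weights give them the
-- totals 13 and 26.
weight : Letter → Fin 13
weight a = # 1
weight b = # 4

valuation : Word → Fin 13
valuation = foldr (λ c g → weight c ⊕ g) 0₁₃

valuation-homo : IsMorphismTo (ℤ/ 13) valuation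
valuation-homo = record
  { isMagmaHomomorphism = record
    { isRelHomomorphism = record { cong = cong valuation }
    ; homo = valuation-++
    }
  ; ε-homo = refl
  }
  where
  valuation-++ : ∀ u v → valuation (u ++ v) ≡ valuation u ⊕ valuation v
  valuation-++ []      v = sym (AbelianGroup.identityˡ (ℤ/ 13) (valuation v))
  valuation-++ (c ∷ u) v = trans (cong (weight c ⊕_) (valuation-++ u v))
    (sym (AbelianGroup.assoc (ℤ/ 13) (weight c) (valuation u) (valuation v)))

-- Dekking's conditions by exhaustive check.

open DecMembership (Fin._≟_ {13}) using () renaming (_∈?_ to _∈ₗ?_)

avoided : List (Fin 13)
avoided = # 4 ∷ # 12 ∷ []

abstract
  -- A nonzero `d` has order 13, so the twelve terms are distinct and cannot miss both avoided
  -- residues. The check runs through all pairs.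
  progression-hits-avoided : ∀ g d → d ≢ 0₁₃ → ∃[ i ] (g ⊕ (toℕ {12} i · d)) ∈ₗ avoided
  progression-hits-avoided = from-yes (all? λ g → all? λ d → ¬? (d Fin.≟ 0₁₃) →-dec
    any? λ i → (g ⊕ (toℕ {12} i · d)) ∈ₗ? avoided)

abstract
  prefixes-avoid : ∀ σ → All (λ (v , _) → valuation v ∉ₗ avoided) (splits (morphism [ σ ]))
  prefixes-avoid = from-yes (all? λ σ → All.all? (λ (v , _) → ¬? (valuation v ∈ₗ? avoided)) (splits (morphism [ σ ])))

SameValueProper : Fin 13 → (Word × Word → Set) → Set
SameValueProper g P = ∀ τ → All (λ s → proj₂ s ≢ [] → valuation (proj₁ s) ≡ g → P s) (splits (morphism [ τ ]))

_≟ʷ_ : (u v : Word) → Dec (u ≡ v)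
_≟ʷ_ = ≡-dec Fin._≟_

sameValueProper? : ∀ g {P} → (∀ s → Dec (P s)) → Dec (SameValueProper g P)
sameValueProper? g P? = all? λ τ → All.all?
  (λ s → ¬? (proj₂ s ≟ʷ []) →-dec ((valuation (proj₁ s) Fin.≟ g) →-dec P? s)) (splits (morphism [ τ ]))

abstract
  -- D4 concerns families of every length `r`, which cannot be enumerated. Fixing one proper prefix
  -- as reference makes it finite: a single alternative must serve all proper prefixes with the same
  -- value.
  same-value-proper : ∀ σ → All (λ (v , v′) → v′ ≢ [] →
      SameValueProper (valuation v) (λ s → proj₁ s ≡ v) ⊎ SameValueProper (valuation v) (λ s → proj₂ s ≡ v′))
    (splits (morphism [ σ ]))
  same-value-proper = from-yes (all? λ σ → All.all?
    (λ (v , v′) → ¬? (v′ ≟ʷ []) →-dec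
      (sameValueProper? (valuation v) (λ s → proj₁ s ≟ʷ v) ⊎-dec
       sameValueProper? (valuation v) (λ s → proj₂ s ≟ʷ v′)))
    (splits (morphism [ σ ])))

dekking : DekkingConditions morphism (ℤ/ 13) valuation 11
dekking = record
  -- The determinant evaluates to 5 · 5 - 2 · 6 = 13.
  { D1 = λ ()
  ; D2 = λ { a → refl ; b → refl }
  ; D3 = D3
  ; D4 = D4
  }
  where
  D3 : ∀ g d → d ≢ 0₁₃ →
    ¬ (∀ i → i ≤ 11 → ∃[ v ] (v ∈ Pref morphism × valuation v ≡ g ⊕ (i · d)))
  D3 g d d≢0 prog with progression-hits-avoided g d d≢0
  ... | i , hit with prog (toℕ i) (toℕ≤pred[n] i)
  ...   | v , (σ , v′ , eq) , value =
    All.lookup (prefixes-avoid σ) (∈-splits v v′ eq) (subst (_∈ₗ avoided) (sym value) hit)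

  D4 : ∀ r → r > 0 → (σ : Fin r → Letter) (v v′ : Fin r → Word) →
    (∀ i → v i ++ v′ i ≡ morphism [ σ i ]) →
    (∀ i → v i ∉ LetterImages morphism) →
    (∀ i j → valuation (v i) ≡ valuation (v j)) →
    (∀ i j → v i ≡ v j) ⊎ (∀ i j → v′ i ≡ v′ j)
  D4 (suc r) _ σ v v′ factors notImage same =
    [ (λ p → inj₁ λ i j → trans (specialise p i) (sym (specialise p j)))
    , (λ p → inj₂ λ i j → trans (specialise p i) (sym (specialise p j)))
    ]′ (All.lookup (same-value-proper (σ zero)) (split zero) (proper zero))
    where
    split : ∀ i → (v i , v′ i) ∈ₗ splits (morphism [ σ i ])
    split i = ∈-splits (v i) (v′ i) (factors i)

    proper : ∀ i → v′ i ≢ []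
    proper i v′≡[] = notImage i
      (σ i , trans (sym (++-identityʳ (v i))) (trans (cong (v i ++_) (sym v′≡[])) (factors i)))

    specialise : ∀ {P} → SameValueProper (valuation (v zero)) P → ∀ i → P (v i , v′ i)
    specialise p i = All.lookup (p (σ i)) (split i) (proper i) (same i zero)

prefix-code : ∀ σ τ v → morphism [ σ ] ++ v ≡ morphism [ τ ] → v ≡ []
prefix-code a a v eq = ++-cancelˡ (image a) v [] eq
prefix-code b b v eq = ++-cancelˡ (image b) v [] eq
prefix-code a b v ()
prefix-code b a v ()

open Dekking morphism-homo (13 , inverse _) valuation-homo dekking prefix-code using (preserves)

-- The fixed point

iterates : ℕ → Word
iterates zero    = [ a ]
iterates (suc k) = morphism (iterates k)

-- `image a` begins with `a`, and the morphism preserves the prefix relation.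
iterates-suc : ∀ k → ∃[ s ] iterates (suc k) ≡ iterates k ++ s
iterates-suc zero    = _ , refl
iterates-suc (suc k) with iterates-suc k
... | s , eq = morphism s , trans (cong morphism eq) (concatMap-++ image (iterates k) s)

iterates-mono : ∀ {k l} → k ≤ l → ∃[ s ] iterates l ≡ iterates k ++ s
iterates-mono {k} k≤l with ℕₚ.≤⇒≤′ k≤l
... | le = go le
  where
  go : ∀ {l} → k ≤′ l → ∃[ s ] iterates l ≡ iterates k ++ s
  go ≤′-refl = [] , sym (++-identityʳ _)
  go (≤′-step {l} k≤l) with go k≤l | iterates-suc l
  ... | s , eq | s′ , eq′ = s ++ s′ , trans eq′ (trans (cong (_++ s′) eq) (++-assoc (iterates k) s s′))

-- Letter images have length at least 2. This gives both the growth of the iterates and the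
-- unboundedness demanded by `IsImage∞`.
length-morphism : ∀ u → length u + length u ≤ length (morphism u)
length-morphism []      = z≤n
length-morphism (c ∷ u) = begin
  suc (length u) + suc (length u)      ≡⟨ shift (length u) ⟩
  2 + (length u + length u)            ≤⟨ ℕₚ.+-mono-≤ (two c) (length-morphism u) ⟩
  length (image c) + length (morphism u)  ≡⟨ length-++ (image c) ⟨
  length (morphism (c ∷ u))            ∎
  where
  open ≤-Reasoning
  shift : ∀ m → suc m + suc m ≡ 2 + (m + m)
  shift = solve-∀
  two : ∀ c → 2 ≤ length (image c)
  two a = s≤s (s≤s z≤n)
  two b = s≤s (s≤s z≤n)

iterates-long : ∀ k → k < length (iterates k)
iterates-long zero    = s≤s z≤n
iterates-long (suc k) = begin
  2 + k                                      ≡⟨ ℕₚ.+-comm 1 (suc k) ⟩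
  suc k + 1                                  ≤⟨ ℕₚ.+-mono-≤ (iterates-long k) (ℕₚ.≤-trans (s≤s z≤n) (iterates-long k)) ⟩
  length (iterates k) + length (iterates k)  ≤⟨ length-morphism (iterates k) ⟩
  length (iterates (suc k))                  ∎
  where open ≤-Reasoning

-- The padding by a is never read, because the n-th iterate is longer than n.
fixedPoint : InfWord
fixedPoint n = (iterates n ++∞ (λ _ → a)) n

iterates-prefix : ∀ k → ∃[ y ] fixedPoint ≗ iterates k ++∞ y
iterates-prefix k = _ , agree⇒prefix (iterates k) {λ _ → a} agree
  where
  stable : ∀ {k l n} → k ≤ l → n < length (iterates k) → (iterates k ++∞ (λ _ → a)) n ≡ (iterates l ++∞ (λ _ → a)) n
  stable {k} {l} {n} k≤l n< with iterates-mono k≤l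
  ... | s , eq = begin
    (iterates k ++∞ (λ _ → a)) n        ≡⟨ ++∞-local (iterates k) n< ⟩
    (iterates k ++∞ s ++∞ (λ _ → a)) n  ≡⟨ ++∞-assoc (iterates k) s _ n ⟨
    ((iterates k ++ s) ++∞ (λ _ → a)) n ≡⟨ cong (λ w → (w ++∞ (λ _ → a)) n) eq ⟨
    (iterates l ++∞ (λ _ → a)) n        ∎
    where open ≡-Reasoning

  agree : ∀ n → n < length (iterates k) → fixedPoint n ≡ (iterates k ++∞ (λ _ → a)) n
  -- The fixed point reads position `n` in iterate `n`, the claim reads it in iterate `k`; the
  -- earlier iterate is a prefix of the later one and already contains this position.
  agree n n< with ℕₚ.≤-total n k
  ... | inj₁ n≤k = stable n≤k (iterates-long n)
  ... | inj₂ k≤n = sym (stable k≤n n<)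

iterates-prefixes : ∀ {P} → (∀ k → P (iterates k)) → HasPrefixesIn P fixedPoint
iterates-prefixes P-iterates k = iterates k , P-iterates k , ℕₚ.<⇒≤ (iterates-long k) , iterates-prefix k

fixedPoint-isFixed : IsFixedPoint morphism fixedPoint
fixedPoint-isFixed = image-prefix , λ m → m , long m
  where
  image-prefix : ∀ n → ∃[ y ] fixedPoint ≗ morphism (applyUpTo fixedPoint n) ++∞ y
  -- The prefix of length `n` lies within iterate `n`, whose image is iterate `suc n`, again a
  -- prefix of the fixed point.
  image-prefix n with iterates-prefix n | iterates-prefix (suc n)
  ... | y , eq | z , eq′
    with prefix-extend (applyUpTo fixedPoint n) (iterates n)
           (subst (_≤ length (iterates n)) (sym (length-applyUpTo fixedPoint n)) (ℕₚ.<⇒≤ (iterates-long n)))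
           (λ i → trans (sym (applyUpTo-prefix fixedPoint n i)) (eq i))
  ...   | s , split = morphism s ++∞ z , λ i → begin
    fixedPoint i                                                     ≡⟨ eq′ i ⟩
    (morphism (iterates n) ++∞ z) i                                  ≡⟨ cong (λ w → (morphism w ++∞ z) i) split ⟩
    (morphism (applyUpTo fixedPoint n ++ s) ++∞ z) i                 ≡⟨ cong (λ w → (w ++∞ z) i) (concatMap-++ image (applyUpTo fixedPoint n) s) ⟩
    ((morphism (applyUpTo fixedPoint n) ++ morphism s) ++∞ z) i      ≡⟨ ++∞-assoc (morphism (applyUpTo fixedPoint n)) (morphism s) z i ⟩
    (morphism (applyUpTo fixedPoint n) ++∞ morphism s ++∞ z) i       ∎
    where open ≡-Reasoning

  long : ∀ m → m ≤ length (morphism (applyUpTo fixedPoint m))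
  long m = begin
    m                                          ≤⟨ ℕₚ.m≤m+n m m ⟩
    m + m                                      ≡⟨ cong (λ l → l + l) (length-applyUpTo fixedPoint m) ⟨
    length u + length u                        ≤⟨ length-morphism u ⟩
    length (morphism u)                        ∎
    where
    open ≤-Reasoning
    u = applyUpTo fixedPoint m

-- Avoided factors and powers of the fixed point.

-- The index k is the number of letters a read since the last b.
data Legal : ℕ → Word → Set where
  []  : ∀ {k} → Legal k []
  a∷_ : ∀ {k u} → Legal (suc k) u → {k<3 : True (k ℕₚ.<? 3)} → Legal k (a ∷ u)
  b∷_ : ∀ {k u} → Legal 0 u → Legal (suc k) (b ∷ u)

infixr 5 a∷_ b∷_

aaaa-illegal : ∀ {k z} → ¬ Legal k (a ∷ a ∷ a ∷ a ∷ z)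
aaaa-illegal {k} (a∷ a∷ a∷ (a∷_ _ {k+3<3})) = ℕₚ.m+n≮m 3 k (toWitness {a? = (3 + k) ℕₚ.<? 3} k+3<3)

bb-illegal : ∀ {k z} → ¬ Legal k (b ∷ b ∷ z)
bb-illegal (b∷ ())

legal-suffix : ∀ x {k y} → Legal k (x ++ y) → ∃[ l ] Legal l y
legal-suffix []      p      = _ , p
legal-suffix (a ∷ x) (a∷ p) = legal-suffix x p
legal-suffix (b ∷ x) (b∷ p) = legal-suffix x p

-- Index 0 treats the start of a word as if a `b` had just been read. Each image starts with `a`, as
-- index 0 demands, and its final `b` resets the index to 0 for the next image.
legal-morphism : ∀ u → Legal 0 (morphism u)
legal-morphism []      = []
legal-morphism (a ∷ u) = a∷ a∷ a∷ b∷ a∷ a∷ b∷ legal-morphism u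
legal-morphism (b ∷ u) = a∷ b∷ a∷ b∷ a∷ b∷ a∷ b∷ a∷ a∷ b∷ legal-morphism u

legal-iterates : ∀ k → Legal 0 (iterates k)
legal-iterates zero    = a∷ []
legal-iterates (suc k) = legal-morphism (iterates k)

fixedPoint-avoids : ∀ w → (∀ {k z} → ¬ Legal k (w ++ z)) → ¬ (w FactorOf∞ fixedPoint)
fixedPoint-avoids w illegal (x , y , eq) with factor-in-prefix (iterates-prefixes {Legal 0} legal-iterates) x w y eq
... | z , legal = illegal (proj₂ (legal-suffix x legal))

-- With at least two blocks, any block shares its counts with the first two, so twice these counts
-- fit into a word of length 1.
powerFree-letter : ∀ {n} σ → AbelianPowerFree (2 + n) [ σ ]
powerFree-letter σ x vs@(v ∷ v′ ∷ ws) y eq parikh i = ψ≗0⇒[] (lookup vs i) λ c → count≡0 c (begin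
  ψ (lookup vs i) c + ψ (lookup vs i) c  ≡⟨ cong₂ _+_ (parikh i zero c) (parikh i (suc zero) c) ⟩
  ψ v c + ψ v′ c                         ≡⟨ ψ-++ v v′ c ⟨
  ψ (v ++ v′) c                          ≤⟨ ℕₚ.m≤n+m _ (ψ x c) ⟩
  ψ x c + ψ (v ++ v′) c                  ≡⟨ ψ-++ x (v ++ v′) c ⟨
  ψ (x ++ v ++ v′) c                     ≤⟨ ℕₚ.m≤m+n _ _ ⟩
  ψ (x ++ v ++ v′) c + ψ (concat (toList ws) ++ y) c  ≡⟨ ψ-++ (x ++ v ++ v′) _ c ⟨
  ψ ((x ++ v ++ v′) ++ concat (toList ws) ++ y) c     ≡⟨ cong (λ u → ψ u c) (trans eq regroup) ⟨
  ψ [ σ ] c                              ∎)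
  where
  open ≤-Reasoning

  regroup : x ++ (v ++ v′ ++ concat (toList ws)) ++ y ≡ (x ++ v ++ v′) ++ concat (toList ws) ++ y
  regroup = sym (trans (++-assoc x (v ++ v′) _) (cong (x ++_) (trans (sym (++-assoc (v ++ v′) _ y))
    (cong (_++ y) (++-assoc v v′ _)))))

  count≡0 : ∀ c {m} → m + m ≤ ψ [ σ ] c → m ≡ 0
  count≡0 c {zero}  _  = refl
  count≡0 c {suc m} le = contradiction
    (ℕₚ.≤-trans le (length-filter (c Fin.≟_) [ σ ])) (ℕₚ.<⇒≱ (s≤s (ℕₚ.m≤n⇒m≤o+n m (s≤s z≤n))))

powerFree-iterates : ∀ k → AbelianPowerFree 11 (iterates k)
powerFree-iterates zero    = powerFree-letter a
powerFree-iterates (suc k) = preserves (iterates k) (powerFree-iterates k)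

theorem2p23 : Σ[ h ∈ (Word → Word) ] Σ[ G ∈ AbelianGroup 0ℓ 0ℓ ] Σ[ f ∈ (Word → AbelianGroup.Carrier G) ]
    ( IsMorphism h
    × IsFinite G
    × IsMorphismTo G f
    × DekkingConditions h G f 11
    × AbelianPowerFreeMorphism 11 h
    × ∃[ Ω ] ( IsFixedPoint h Ω
    × ¬ ((a ∷ a ∷ a ∷ a ∷ []) FactorOf∞ Ω)
    × ¬ ((b ∷ b ∷ []) FactorOf∞ Ω)
    × AbelianPowerFree∞ 11 Ω ) )
theorem2p23 =
  morphism , ℤ/ 13 , valuation , morphism-homo , (13 , inverse _) , valuation-homo , dekking ,
  powerFree⇒morphism preserves ,
  fixedPoint , fixedPoint-isFixed ,
  fixedPoint-avoids (a ∷ a ∷ a ∷ a ∷ []) aaaa-illegal ,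
  fixedPoint-avoids (b ∷ b ∷ []) bb-illegal ,
  prefixes⇒powerFree∞ (iterates-prefixes {AbelianPowerFree 11} powerFree-iterates)
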